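{- Let $E$ be a finite directed graph and fix $\lambda\in\mathbb{R}$. Let $\partial:C_1\to C_0$ be the boundary map of the chain complex of $E$ with parameter $\lambda$, and let $H^0=\ker(\delta)$ be the degree-zero cohomology of the dual cochain complex. Then there are nontrivial special generalized graph weights on $E$ with parameter $\lambda$ (that is, with vertex function $g\neq 0$) if and only if $H^0\neq 0$. This happens if and only if $\det(\partial)=0$.
   Context: $E=(E^0,E^1,s,r)$ is a finite directed graph with source and range maps $s,r$. For $v\in E^0$ let $B_v=\{e\in E^1: s(e)=v\}$ (the edge bundle at $v$); $v$ is a sink if $B_v=\emptyset$. A generalized graph weight on $E$ is a pair of real-valued functions $(g,\lambda)$ on $E^0$ and $E^1$ with $g(v)=\sum_{e\in B_v}\lambda(e)g(r(e))$ for every $v\in E^0$ that is not a sink; it is special if $\lambda$ is constant, and then the constant $\lambda$ is its parameter; for fixed parameter it is identified with the function $g$. Chain complex: $0\to C_1\xrightarrow{\partial}C_0\to0$, where $C_0=\bigoplus_{v\in E^0}\mathbb{R}v$ has the vertices as basis, $C_1=\bigoplus_{v\in E^0}\mathbb{R}B_v$ has as basis one formal symbol $B_v$ for each vertex $v$ (including sinks), and $\partial(B_v)=0$ if $v$ is a sink, $\partial(B_v)=\lambda\sum_{e\in B_v}r(e)-v$ otherwise. The determinant of $\partial$ is taken with respect to the bases $\{B_v\}$ and $\{v\}$. The dual cochain complex is $0\leftarrow C^1\xleftarrow{\delta}C^0\leftarrow0$, with $C^i=\mathrm{Hom}(C_i,\mathbb{R})$ and $\delta g=g\circ\partial$. 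-}

module Defs where

open import Level using (Level; _⊔_; suc)
open import Algebra.Bundles using (CommutativeMonoid; CommutativeRing; Ring; AbelianGroup)
open import Algebra.Core using (Op₁; Op₂)
open import Algebra.Structures using (IsCommutativeRing)
open import Algebra.Module.Bundles using (LeftModule)
open import Algebra.Module.Morphism.Structures using (module LeftModuleMorphisms)
import Algebra.Construct.Pointwise as Pointwise
import Algebra.Module.Construct.TensorUnit as TensorUnit
import Algebra.Module.Morphism.Construct.Composition as Composition
import Algebra.Properties.AbelianGroup as AbelianGroupProperties
import Algebra.Properties.CommutativeMonoid.Sum as Sum
import Algebra.Properties.Semiring.Exp as Exp
open import Data.Bool.Base using (if_then_else_)
open import Data.Fin.Base as Fin using (Fin; toℕ; punchIn)
open import Data.Fin.Properties using (_≟_)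
open import Data.List.Base using (List; []; foldr; filter; allFin; null)
open import Data.Nat.Base as ℕ using (ℕ)
open import Data.Product.Base using (Σ; _×_; ∃)
open import Function.Base using (_∘_)
open import Relation.Binary.Core using (Rel)
open import Relation.Binary.PropositionalEquality.Core using (_≡_)
open import Relation.Binary.Structures using (IsDecTotalOrder)
open import Relation.Nullary.Decidable.Core using (does)
open import Relation.Nullary.Negation.Core using (¬_)
open import Relation.Unary using (Pred; Satisfiable)

-- The real numbers, given by their characterisation (unique up to
-- isomorphism) as the Dedekind-complete ordered field.  The order, hence the
-- equality, is decidable, as it is for the classical real numbers.
record RealNumbers (c ℓ₁ ℓ₂ : Level) : Set (suc (c ⊔ ℓ₁ ⊔ ℓ₂)) where
  infix  8 -_
  infixl 7 _*_
  infixl 6 _+_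
  infix  4 _≈_ _≤_
  field
    Carrier           : Set c
    _≈_               : Rel Carrier ℓ₁
    _≤_               : Rel Carrier ℓ₂
    _+_               : Op₂ Carrier
    _*_               : Op₂ Carrier
    -_                : Op₁ Carrier
    0#                : Carrier
    1#                : Carrier
    isCommutativeRing : IsCommutativeRing _≈_ _+_ _*_ -_ 0# 1#
    0≉1               : ¬ (0# ≈ 1#)
    inverse           : ∀ x → ¬ (x ≈ 0#) → ∃ λ y → x * y ≈ 1#
    isDecTotalOrder   : IsDecTotalOrder _≈_ _≤_
    +-monoˡ-≤         : ∀ {x y} z → x ≤ y → x + z ≤ y + z
    *-nonNegative     : ∀ {x y} → 0# ≤ x → 0# ≤ y → 0# ≤ x * y

  UpperBound : Pred Carrier (c ⊔ ℓ₁ ⊔ ℓ₂) → Pred Carrier (c ⊔ ℓ₁ ⊔ ℓ₂)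
  UpperBound P b = ∀ x → P x → x ≤ b

  field
    supremum : (P : Pred Carrier (c ⊔ ℓ₁ ⊔ ℓ₂)) → Satisfiable P → Satisfiable (UpperBound P) →
               ∃ λ s → UpperBound P s × (∀ b → UpperBound P b → s ≤ b)

  commutativeRing : CommutativeRing c ℓ₁
  commutativeRing = record { isCommutativeRing = isCommutativeRing }

  open CommutativeRing commutativeRing public
    using (ring; semiring; +-commutativeMonoid; +-abelianGroup)

-- Loops and parallel edges are allowed.
record FiniteDigraph : Set where
  field
    ∣E⁰∣ ∣E¹∣ : ℕ

  E⁰ : Set
  E⁰ = Fin ∣E⁰∣

  E¹ : Set
  E¹ = Fin ∣E¹∣

  field
    s r : E¹ → E⁰

  B : E⁰ → List E¹
  B v = filter (λ e → s e ≟ v) (allFin ∣E¹∣)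

  Sink : Pred E⁰ Level.zero
  Sink v = B v ≡ []

module ListSum {c ℓ : Level} (M : CommutativeMonoid c ℓ) where
  open CommutativeMonoid M

  ∑ : {A : Set} → List A → (A → Carrier) → Carrier
  ∑ xs f = foldr (λ x acc → f x ∙ acc) ε xs

module LinearAlgebra {c ℓ₁ ℓ₂ : Level} (ℝ : RealNumbers c ℓ₁ ℓ₂) where
  open RealNumbers ℝ
  private module R = Ring ring

  record Hom {m₁ ℓm₁ m₂ ℓm₂ : Level}
             (M : LeftModule ring m₁ ℓm₁) (N : LeftModule ring m₂ ℓm₂) :
             Set (c ⊔ m₁ ⊔ ℓm₁ ⊔ m₂ ⊔ ℓm₂) where
    private
      module M = LeftModule M
      module N = LeftModule N
    open LeftModuleMorphisms M.rawLeftModule N.rawLeftModule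
    field
      ⟦_⟧                      : M.Carrierᴹ → N.Carrierᴹ
      isLeftModuleHomomorphism : IsLeftModuleHomomorphism ⟦_⟧

    IsZero : Set (m₁ ⊔ ℓm₂)
    IsZero = ∀ x → ⟦_⟧ x N.≈ᴹ N.0ᴹ

  open Hom public using (⟦_⟧; IsZero)

  infixr 9 _∘ʰ_

  _∘ʰ_ : {m₁ ℓm₁ m₂ ℓm₂ m₃ ℓm₃ : Level}
         {M : LeftModule ring m₁ ℓm₁} {N : LeftModule ring m₂ ℓm₂} {P : LeftModule ring m₃ ℓm₃} →
         Hom N P → Hom M N → Hom M P
  _∘ʰ_ {P = P} g f = record
    { ⟦_⟧ = ⟦ g ⟧ ∘ ⟦ f ⟧
    ; isLeftModuleHomomorphism = Composition.isLeftModuleHomomorphism (LeftModule.≈ᴹ-trans P)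
        (Hom.isLeftModuleHomomorphism f) (Hom.isLeftModuleHomomorphism g)
    }

  scalars : LeftModule ring c ℓ₁
  scalars = TensorUnit.leftModule

  Dual : {m ℓm : Level} → LeftModule ring m ℓm → Set (c ⊔ ℓ₁ ⊔ m ⊔ ℓm)
  Dual M = Hom M scalars

  -- The free module on a basis indexed by Fin n: an element is its family of
  -- coordinates.
  Free : ℕ → LeftModule ring c ℓ₁
  Free n = record
    { Carrierᴹ     = A.Carrier
    ; _≈ᴹ_         = A._≈_
    ; _+ᴹ_         = A._∙_
    ; _*ₗ_         = λ a x i → a * x i
    ; 0ᴹ           = A.ε
    ; -ᴹ_          = A._⁻¹
    ; isLeftModule = record
      { isLeftSemimodule = record
        { +ᴹ-isCommutativeMonoid = A.isCommutativeMonoid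
        ; isPreleftSemimodule    = record
          { *ₗ-cong      = λ p q i → R.*-cong p (q i)
          ; *ₗ-zeroˡ     = λ x i → R.zeroˡ (x i)
          ; *ₗ-distribʳ  = λ x a b i → R.distribʳ (x i) a b
          ; *ₗ-identityˡ = λ x i → R.*-identityˡ (x i)
          ; *ₗ-assoc     = λ a b x i → R.*-assoc a b (x i)
          ; *ₗ-zeroʳ     = λ a i → R.zeroʳ a
          ; *ₗ-distribˡ  = λ a x y i → R.distribˡ a (x i) (y i)
          }
        }
      ; -ᴹ‿cong    = A.⁻¹-cong
      ; -ᴹ‿inverse = A.inverse
      }
    }
    where module A = AbelianGroup (Pointwise.abelianGroup (Fin n) +-abelianGroup)

  basis : {n : ℕ} → Fin n → LeftModule.Carrierᴹ (Free n)
  basis i j = if does (i ≟ j) then 1# else 0#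

  module _ {m ℓm : Level} {n : ℕ} (M : LeftModule ring m ℓm) where
    open LeftModule M
    open Sum +ᴹ-commutativeMonoid using (sum; sum-cong-≋; sum-replicate-zero; ∑-distrib-+)

    private
      sum-*ₗ : ∀ {k} a (x : Fin k → Carrierᴹ) → sum (λ i → a *ₗ x i) ≈ᴹ a *ₗ sum x
      sum-*ₗ {ℕ.zero}  a x = ≈ᴹ-sym (*ₗ-zeroʳ a)
      sum-*ₗ {ℕ.suc k} a x = ≈ᴹ-trans (+ᴹ-cong ≈ᴹ-refl (sum-*ₗ a (x ∘ Fin.suc)))
                                      (≈ᴹ-sym (*ₗ-distribˡ a _ _))

    -- The linear map sending the i-th basis element to b i.
    linearExtension : (Fin n → Carrierᴹ) → Hom (Free n) M
    linearExtension b = record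
      { ⟦_⟧ = f
      ; isLeftModuleHomomorphism = record
        { +ᴹ-isGroupHomomorphism = record
          { isMonoidHomomorphism = record
            { isMagmaHomomorphism = record
              { isRelHomomorphism = record { cong = f-cong }
              ; homo              = f-+
              }
            ; ε-homo = f-0
            }
          ; ⁻¹-homo = λ x → -ᴹ-unique (f (-ᶠ x)) (f x)
              (≈ᴹ-trans (≈ᴹ-sym (f-+ (-ᶠ x) x)) (≈ᴹ-trans (f-cong (F.-ᴹ‿inverseˡ x)) f-0))
          }
        ; *ₗ-homo = λ a x → ≈ᴹ-trans (sum-cong-≋ {n} (λ i → *ₗ-assoc a (x i) (b i))) (sum-*ₗ {n} a _)
        }
      }
      where
      module F = LeftModule (Free n)
      open F using () renaming (-ᴹ_ to -ᶠ_)
      open AbelianGroupProperties +ᴹ-abelianGroup using () renaming (inverseˡ-unique to -ᴹ-unique)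

      f : F.Carrierᴹ → Carrierᴹ
      f x = sum (λ i → x i *ₗ b i)

      f-cong : ∀ {x y} → x F.≈ᴹ y → f x ≈ᴹ f y
      f-cong p = sum-cong-≋ {n} (λ i → *ₗ-cong (p i) ≈ᴹ-refl)

      f-+ : ∀ x y → f (x F.+ᴹ y) ≈ᴹ f x +ᴹ f y
      f-+ x y = ≈ᴹ-trans (sum-cong-≋ {n} (λ i → *ₗ-distribʳ (b i) (x i) (y i))) (∑-distrib-+ {n} _ _)

      f-0 : f F.0ᴹ ≈ᴹ 0ᴹ
      f-0 = ≈ᴹ-trans (sum-cong-≋ {n} (λ i → *ₗ-zeroˡ (b i))) (sum-replicate-zero n)

  Matrix : ℕ → Set c
  Matrix n = Fin n → Fin n → Carrier

  open Sum +-commutativeMonoid using (sum-syntax)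
  open Exp semiring using (_^_)

  -- Laplace expansion along the first row.
  detMatrix : {n : ℕ} → Matrix n → Carrier
  detMatrix {ℕ.zero}  A = 1#
  detMatrix {ℕ.suc n} A =
    ∑[ j < ℕ.suc n ] ((- 1#) ^ toℕ j * (A Fin.zero j * detMatrix (λ i k → A (Fin.suc i) (punchIn j k))))

  -- Columns are the coordinates of the images of the basis elements.
  matrix : {n : ℕ} → Hom (Free n) (Free n) → Matrix n
  matrix f i j = ⟦ f ⟧ (basis j) i

  det : {n : ℕ} → Hom (Free n) (Free n) → Carrier
  det f = detMatrix (matrix f)

module Weights {c ℓ₁ ℓ₂ : Level} (ℝ : RealNumbers c ℓ₁ ℓ₂) (E : FiniteDigraph) where
  open RealNumbers ℝ
  open FiniteDigraph E
  open ListSum +-commutativeMonoid using (∑)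

  record GeneralizedGraphWeight : Set (c ⊔ ℓ₁) where
    field
      g         : E⁰ → Carrier
      edge      : E¹ → Carrier
      condition : ∀ v → ¬ Sink v → g v ≈ ∑ (B v) (λ e → edge e * g (r e))

    Nontrivial : Set ℓ₁
    Nontrivial = ¬ (∀ v → g v ≈ 0#)

    SpecialWithParameter : Carrier → Set ℓ₁
    SpecialWithParameter λ₀ = ∀ e → edge e ≈ λ₀

  open GeneralizedGraphWeight public using (Nontrivial; SpecialWithParameter)

  HasNontrivialSpecialWeight : Carrier → Set (c ⊔ ℓ₁)
  HasNontrivialSpecialWeight λ₀ =
    Σ GeneralizedGraphWeight λ w → SpecialWithParameter w λ₀ × Nontrivial w

module ChainComplex {c ℓ₁ ℓ₂ : Level} (ℝ : RealNumbers c ℓ₁ ℓ₂) (E : FiniteDigraph)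
                    (λ₀ : RealNumbers.Carrier ℝ) where
  open RealNumbers ℝ
  open FiniteDigraph E
  open LinearAlgebra ℝ

  C₀ : LeftModule ring c ℓ₁
  C₀ = Free ∣E⁰∣

  -- The basis element with index v is the formal symbol B_v.
  C₁ : LeftModule ring c ℓ₁
  C₁ = Free ∣E⁰∣

  open LeftModule C₀ using (Carrierᴹ; _+ᴹ_; _*ₗ_; 0ᴹ; -ᴹ_; +ᴹ-commutativeMonoid)
  open ListSum +ᴹ-commutativeMonoid using (∑)

  ∂B : E⁰ → Carrierᴹ
  ∂B v = if null (B v) then 0ᴹ else λ₀ *ₗ ∑ (B v) (λ e → basis (r e)) +ᴹ -ᴹ basis v

  ∂ : Hom C₁ C₀
  ∂ = linearExtension C₀ ∂B

  C⁰ : Set (c ⊔ ℓ₁)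
  C⁰ = Dual C₀

  C¹ : Set (c ⊔ ℓ₁)
  C¹ = Dual C₁

  δ : C⁰ → C¹
  δ g = g ∘ʰ ∂

  H⁰ : Pred C⁰ (c ⊔ ℓ₁)
  H⁰ g = IsZero (δ g)

  H⁰≠0 : Set (c ⊔ ℓ₁)
  H⁰≠0 = Σ C⁰ λ g → H⁰ g × ¬ IsZero g

{-# OPTIONS --safe #-}
module Submission where

open import Level using (Level; _⊔_)
open import Algebra.Bundles using (CommutativeRing)
open import Algebra.Module.Bundles using (LeftModule)
open import Algebra.Module.Morphism.Structures using (module LeftModuleMorphisms)
import Algebra.Properties.CommutativeMonoid.Sum as CommutativeMonoidSum
import Algebra.Properties.Ring as RingProperties
import Algebra.Properties.Semiring.Exp as Exp
import Algebra.Properties.Semiring.Sum as SemiringSum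
import Algebra.Solver.Ring.NaturalCoefficients.Default as RingSolver
open import Data.Bool.Base using (if_then_else_)
open import Data.Fin.Base using (Fin; zero; suc; toℕ; fromℕ; inject₁; punchIn; punchOut; _<_)
open import Data.Fin.Induction using (>-weakInduction)
open import Data.Fin.Properties
  using (_≟_; suc-injective; punchInᵢ≢i; punchIn-injective; punchIn-punchOut; toℕ-inject₁; ≤∧≢⇒<; ≤fromℕ; <⇒≢)
open import Data.List.Base using (List; []; _∷_; null)
open import Data.Nat.Base as ℕ using (ℕ; zero; suc; z<s)
open import Data.Nat.Properties using (<⇒≱)
open import Data.Product.Base using (Σ; ∃; _×_; _,_; proj₁; proj₂)
open import Data.Sum.Base using (_⊎_; inj₁; inj₂)
open import Data.Vec.Functional using (updateAt) renaming (_∷_ to _◁_)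
open import Data.Vec.Functional.Properties using (updateAt-updates; updateAt-minimal)
open import Function.Base using (_∘_; const)
open import Function.Bundles using (_⇔_; mk⇔; Equivalence)
open import Function.Construct.Composition using (_⇔-∘_)
open import Function.Construct.Identity using (⇔-id)
open import Relation.Binary.PropositionalEquality.Core as ≡ using (_≡_; _≢_)
open import Relation.Binary.Structures using (IsDecTotalOrder)
import Relation.Binary.Reasoning.Setoid as SetoidReasoning
open import Relation.Nullary using (¬_; Dec; yes; no; contradiction)
open import Defs

-- A cochain h is determined by its values g(v) = h(v) on the vertices, and
-- h(∂B_v) = 0 is the weight condition of g at v; so nonzero cocycles, nontrivial
-- weights and nonzero row vectors g with g·∂ = 0 are the same thing.  A square
-- matrix A has such a g iff det A = 0: adding a multiple of a column to an
-- adjacent one preserves both sides, and reduces the first row of A to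
-- (a, 0, …, 0), where det A = a · det A′ for the lower right block A′ and induction
-- applies.  Adjacent columns suffice, and for them the alternating property
-- follows from first-row Laplace expansion: only two terms survive, and they cancel.

-- Indices of adjacent columns under deletion of a column.

inject₁≢suc : ∀ {n} (i : Fin n) → inject₁ i ≢ suc i
inject₁≢suc zero    ()
inject₁≢suc (suc i) eq = inject₁≢suc i (suc-injective eq)

-- Deleting a third column leaves adjacent columns adjacent.
punchIn-adjacent : ∀ {n} (k : Fin (suc (suc n))) (i : Fin (suc n)) → k ≢ inject₁ i → k ≢ suc i →
                   ∃ λ (j : Fin n) → punchIn k (inject₁ j) ≡ inject₁ i × punchIn k (suc j) ≡ suc i
punchIn-adjacent zero          zero    k≢i k≢1+i = contradiction ≡.refl k≢i
punchIn-adjacent zero          (suc i) k≢i k≢1+i = i , ≡.refl , ≡.refl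
punchIn-adjacent (suc zero)    zero    k≢i k≢1+i = contradiction ≡.refl k≢1+i
punchIn-adjacent {suc n} (suc (suc k)) zero    k≢i k≢1+i = zero , ≡.refl , ≡.refl
punchIn-adjacent {suc n} (suc k)       (suc i) k≢i k≢1+i
  with j , p , q ← punchIn-adjacent k i (k≢i ∘ ≡.cong suc) (k≢1+i ∘ ≡.cong suc)
  = suc j , ≡.cong suc p , ≡.cong suc q

-- Deleting one or the other of two adjacent columns leaves the same columns in the same places,
-- except where the surviving one of the two stands. If these two are equal, the resulting minors
-- agree.
punchIn-inject₁-suc : ∀ {n} (i j : Fin n) →
                      punchIn (inject₁ i) j ≡ punchIn (suc i) j ⊎
                      (punchIn (inject₁ i) j ≡ suc i × punchIn (suc i) j ≡ inject₁ i)
punchIn-inject₁-suc zero    zero    = inj₂ (≡.refl , ≡.refl)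
punchIn-inject₁-suc zero    (suc j) = inj₁ ≡.refl
punchIn-inject₁-suc (suc i) zero    = inj₁ ≡.refl
punchIn-inject₁-suc (suc i) (suc j) with punchIn-inject₁-suc i j
... | inj₁ eq      = inj₁ (≡.cong suc eq)
... | inj₂ (p , q) = inj₂ (≡.cong suc p , ≡.cong suc q)

-- Determinants and left kernels of square matrices.

module Determinant {c ℓ₁ ℓ₂ : Level} (ℝ : RealNumbers c ℓ₁ ℓ₂) where
  open RealNumbers ℝ
  open LinearAlgebra ℝ
  open CommutativeRing commutativeRing
    using ( refl; sym; trans; setoid; reflexive; commutativeSemiring
          ; +-cong; +-congˡ; +-congʳ; *-cong; *-congˡ; *-congʳ; -‿cong
          ; +-identityˡ; +-identityʳ; *-identityˡ; *-identityʳ; zeroˡ; zeroʳ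
          ; *-assoc; *-comm; -‿inverseʳ; -‿inverseˡ )
  open RingProperties ring using (-1*x≈-x; -‿distribˡ-*)
  open SemiringSum semiring using (sum; sum-cong-≋; sum-replicate-zero; ∑-distrib-+; *-distribˡ-sum)
  open Exp semiring using (_^_)
  open RingSolver commutativeSemiring using (solve; _:+_; _:*_; _:=_)
  open SetoidReasoning setoid

  infix 4 _≈?_
  _≈?_ : ∀ x y → Dec (x ≈ y)
  _≈?_ = IsDecTotalOrder._≟_ isDecTotalOrder

  -- Solves `t * x ≈ - y` for `t`; serves both to eliminate an entry and to extend an annihilating
  -- vector by one coordinate.
  negated-quotient : ∀ {x x⁻¹} y → x * x⁻¹ ≈ 1# → - (y * x⁻¹) * x ≈ - y
  negated-quotient {x} {x⁻¹} y xx⁻¹≈1 = begin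
    - (y * x⁻¹) * x    ≈⟨ -‿distribˡ-* _ x ⟨
    - (y * x⁻¹ * x)    ≈⟨ -‿cong (solve 3 (λ y x⁻¹ x → y :* x⁻¹ :* x := y :* (x :* x⁻¹)) refl y x⁻¹ x) ⟩
    - (y * (x * x⁻¹))  ≈⟨ -‿cong (*-congˡ xx⁻¹≈1) ⟩
    - (y * 1#)         ≈⟨ -‿cong (*-identityʳ y) ⟩
    - y                ∎

  sum-cong : ∀ {n} {x y : Fin n → Carrier} → (∀ i → x i ≈ y i) → sum x ≈ sum y
  sum-cong = sum-cong-≋

  sum-zero : ∀ {n} {x : Fin n → Carrier} → (∀ i → x i ≈ 0#) → sum x ≈ 0#
  sum-zero {n} x≈0 = trans (sum-cong x≈0) (sum-replicate-zero n)

  sum-linear : ∀ {n} (x y : Fin n → Carrier) t → sum (λ i → x i + t * y i) ≈ sum x + t * sum y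
  sum-linear x y t = trans (∑-distrib-+ x _) (+-congˡ (sym (*-distribˡ-sum t y)))

  sum-adjacent-cancel : ∀ {n} (x : Fin (suc n) → Carrier) (i : Fin n) →
                        (∀ k → k ≢ inject₁ i → k ≢ suc i → x k ≈ 0#) →
                        x (inject₁ i) + x (suc i) ≈ 0# → sum x ≈ 0#
  sum-adjacent-cancel x zero off cancel = begin
    x zero + (x (suc zero) + sum (λ k → x (suc (suc k))))
      ≈⟨ +-congˡ (+-congˡ (sum-zero (λ k → off (suc (suc k)) (λ ()) (λ ())))) ⟩
    x zero + (x (suc zero) + 0#)
      ≈⟨ +-congˡ (+-identityʳ _) ⟩
    x zero + x (suc zero)
      ≈⟨ cancel ⟩
    0# ∎
  sum-adjacent-cancel x (suc i) off cancel = begin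
    x zero + sum (x ∘ suc)
      ≈⟨ +-cong (off zero (λ ()) (λ ())) (sum-adjacent-cancel (x ∘ suc) i
           (λ k k≢i k≢1+i → off (suc k) (k≢i ∘ suc-injective) (k≢1+i ∘ suc-injective)) cancel) ⟩
    0# + 0#
      ≈⟨ +-identityʳ 0# ⟩
    0# ∎

  -- Linearity and alternation of the determinant in its columns.

  minor : ∀ {n} → Matrix (suc n) → Fin (suc n) → Matrix n
  minor A k i j = A (suc i) (punchIn k j)

  sign : ∀ {n} → Fin n → Carrier
  sign k = (- 1#) ^ toℕ k

  -- For nonempty `A`, `detMatrix A` is by definition `sum (expansion A)`.
  expansion : ∀ {n} → Matrix (suc n) → Fin (suc n) → Carrier
  expansion A k = sign k * (A zero k * detMatrix (minor A k))

  detMatrix-cong : ∀ {n} {A B : Matrix n} → (∀ i j → A i j ≈ B i j) → detMatrix A ≈ detMatrix B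
  detMatrix-cong {zero}  A≈B = refl
  detMatrix-cong {suc n} A≈B = sum-cong λ k → *-congˡ {sign k}
    (*-cong (A≈B zero k) (detMatrix-cong (λ i j → A≈B (suc i) (punchIn k j))))

  -- In the term that deletes column `p` the three minors agree and the entry is linear; in every
  -- other term the entries agree and the minor is linear by induction, column `p` now standing at
  -- `punchOut k≢p`. Three matrices related by hypotheses, rather than an update operation, are a
  -- form that passes directly to minors.
  detMatrix-linear : ∀ {n} (A B C : Matrix n) p t →
                     (∀ i k → k ≢ p → B i k ≈ A i k) → (∀ i k → k ≢ p → C i k ≈ A i k) →
                     (∀ i → C i p ≈ A i p + t * B i p) →
                     detMatrix C ≈ detMatrix A + t * detMatrix B
  detMatrix-linear {suc n} A B C p t B≈A C≈A Cₚ = trans (sum-cong term) (sum-linear (expansion A) (expansion B) t)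
    where
    term : ∀ k → expansion C k ≈
                 expansion A k + t * (expansion B k)
    term k with k ≟ p
    ... | yes ≡.refl = begin
      expansion C k
        ≈⟨ *-congˡ (*-cong (Cₚ zero) (detMatrix-cong (λ i j → C≈A (suc i) _ (punchInᵢ≢i k j)))) ⟩
      sign k * ((A zero k + t * B zero k) * detMatrix (minor A k))
        ≈⟨ solve 5 (λ s a t b m → s :* ((a :+ t :* b) :* m) := s :* (a :* m) :+ t :* (s :* (b :* m))) refl _ _ _ _ _ ⟩
      expansion A k + t * (sign k * (B zero k * detMatrix (minor A k)))
        ≈⟨ +-congˡ (*-congˡ (*-congˡ (*-congˡ (detMatrix-cong (λ i j → B≈A (suc i) _ (punchInᵢ≢i k j)))))) ⟨
      expansion A k + t * (expansion B k)
        ∎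
    ... | no k≢p = begin
      expansion C k
        ≈⟨ *-congˡ (*-cong (C≈A zero k k≢p)
             (detMatrix-linear (minor A k) (minor B k) (minor C k) (punchOut k≢p) t
               (λ i j j≢ → B≈A (suc i) _ (avoids j≢))
               (λ i j j≢ → C≈A (suc i) _ (avoids j≢))
               (λ i → ≡.subst (λ q → C (suc i) q ≈ A (suc i) q + t * B (suc i) q)
                              (≡.sym (punchIn-punchOut k≢p)) (Cₚ (suc i))))) ⟩
      sign k * (A zero k * (detMatrix (minor A k) + t * detMatrix (minor B k)))
        ≈⟨ solve 5 (λ s a m t m′ → s :* (a :* (m :+ t :* m′)) := s :* (a :* m) :+ t :* (s :* (a :* m′))) refl _ _ _ _ _ ⟩
      expansion A k + t * (sign k * (A zero k * detMatrix (minor B k)))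
        ≈⟨ +-congˡ (*-congˡ (*-congˡ (*-congʳ (B≈A zero k k≢p)))) ⟨
      expansion A k + t * (expansion B k)
        ∎
      where
      avoids : ∀ {j} → j ≢ punchOut k≢p → punchIn k j ≢ p
      avoids {j} j≢ eq = j≢ (punchIn-injective k j _ (≡.trans eq (≡.sym (punchIn-punchOut k≢p))))

  -- A term deleting a third column has a minor with two equal adjacent columns, so it vanishes by
  -- induction. The two remaining terms have equal entries and equal minors but opposite signs.
  detMatrix-adjacent-equal : ∀ {n} (A : Matrix (suc n)) (i : Fin n) →
                             (∀ r → A r (inject₁ i) ≈ A r (suc i)) → detMatrix A ≈ 0#
  detMatrix-adjacent-equal {suc n} A i equal = sum-adjacent-cancel (expansion A) i others cancel
    where
    others : ∀ k → k ≢ inject₁ i → k ≢ suc i → expansion A k ≈ 0#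
    others k k≢i k≢1+i with j , p , q ← punchIn-adjacent k i k≢i k≢1+i = begin
      expansion A k
        ≈⟨ *-congˡ (*-congˡ (detMatrix-adjacent-equal (minor A k) j
             (λ r → ≡.subst₂ (λ a b → A (suc r) a ≈ A (suc r) b) (≡.sym p) (≡.sym q) (equal (suc r))))) ⟩
      sign k * (A zero k * 0#)  ≈⟨ *-congˡ (zeroʳ _) ⟩
      sign k * 0#               ≈⟨ zeroʳ _ ⟩
      0#                        ∎

    minors : ∀ r j → minor A (suc i) r j ≈ minor A (inject₁ i) r j
    minors r j with punchIn-inject₁-suc i j
    ... | inj₁ eq      = reflexive (≡.cong (A (suc r)) (≡.sym eq))
    ... | inj₂ (p , q) = ≡.subst₂ (λ a b → A (suc r) a ≈ A (suc r) b) (≡.sym q) (≡.sym p) (equal (suc r))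

    X : Carrier
    X = A zero (inject₁ i) * detMatrix (minor A (inject₁ i))

    cancel : sign (inject₁ i) * X + sign (suc i) * (A zero (suc i) * detMatrix (minor A (suc i))) ≈ 0#
    cancel = begin
      sign (inject₁ i) * X + sign (suc i) * (A zero (suc i) * detMatrix (minor A (suc i)))
        ≈⟨ +-cong (*-congʳ (reflexive (≡.cong ((- 1#) ^_) (toℕ-inject₁ i))))
                  (*-congˡ (*-cong (sym (equal zero)) (detMatrix-cong minors))) ⟩
      -- `inject₁ i` has the same number as `i`, and `sign (suc i)` unfolds to `- 1# * sign i`.
      sign i * X + (- 1# * sign i) * X   ≈⟨ +-congˡ (*-assoc _ _ _) ⟩
      sign i * X + - 1# * (sign i * X)   ≈⟨ +-congˡ (-1*x≈-x _) ⟩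
      sign i * X + - (sign i * X)        ≈⟨ -‿inverseʳ _ ⟩
      0#                                 ∎

  -- Adding a multiple of a column to an adjacent one.

  data Adjacent {n : ℕ} : Fin (suc n) → Fin (suc n) → Set where
    left  : ∀ i → Adjacent (inject₁ i) (suc i)
    right : ∀ i → Adjacent (suc i) (inject₁ i)

  Adjacent⇒≢ : ∀ {n} {p q : Fin (suc n)} → Adjacent p q → q ≢ p
  Adjacent⇒≢ (left i)  = inject₁≢suc i ∘ ≡.sym
  Adjacent⇒≢ (right i) = inject₁≢suc i

  addColumn : ∀ {n} → Fin n → Fin n → Carrier → Matrix n → Matrix n
  addColumn p q t A i = updateAt (A i) p (_+ t * A i q)

  addColumn-updates : ∀ {n} (p q : Fin n) t A i → addColumn p q t A i p ≈ A i p + t * A i q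
  addColumn-updates p q t A i = reflexive (updateAt-updates p (A i))

  addColumn-minimal : ∀ {n} (p q : Fin n) t A i k → k ≢ p → addColumn p q t A i k ≈ A i k
  addColumn-minimal p q t A i k k≢p = reflexive (updateAt-minimal k p (A i) k≢p)

  copyColumn : ∀ {n} → Fin n → Fin n → Matrix n → Matrix n
  copyColumn p q A i = updateAt (A i) p (const (A i q))

  copyColumn-equal : ∀ {n} (p q : Fin n) A i → q ≢ p → copyColumn p q A i p ≈ copyColumn p q A i q
  copyColumn-equal p q A i q≢p =
    reflexive (≡.trans (updateAt-updates p (A i)) (≡.sym (updateAt-minimal q p (A i) q≢p)))

  detMatrix-copyColumn : ∀ {n} {p q : Fin (suc n)} (A : Matrix (suc n)) → Adjacent p q →
                         detMatrix (copyColumn p q A) ≈ 0#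
  detMatrix-copyColumn A adj@(left i)  =
    detMatrix-adjacent-equal (copyColumn (inject₁ i) (suc i) A) i
      (λ r → copyColumn-equal _ _ A r (Adjacent⇒≢ adj))
  detMatrix-copyColumn A adj@(right i) =
    detMatrix-adjacent-equal (copyColumn (suc i) (inject₁ i) A) i
      (λ r → sym (copyColumn-equal _ _ A r (Adjacent⇒≢ adj)))

  -- By linearity in column `p` the determinant changes by `t` times that of `copyColumn p q A`,
  -- whose adjacent columns `p` and `q` are equal.
  detMatrix-addColumn : ∀ {n} {p q : Fin (suc n)} t (A : Matrix (suc n)) → Adjacent p q →
                        detMatrix (addColumn p q t A) ≈ detMatrix A
  detMatrix-addColumn {p = p} {q} t A adj = begin
    detMatrix (addColumn p q t A)
      ≈⟨ detMatrix-linear A (copyColumn p q A) (addColumn p q t A) p t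
           (λ i k k≢p → reflexive (updateAt-minimal k p (A i) k≢p))
           (addColumn-minimal p q t A)
           (λ i → trans (addColumn-updates p q t A i)
                        (+-congˡ (*-congˡ (reflexive (≡.sym (updateAt-updates p (A i))))))) ⟩
    detMatrix A + t * detMatrix (copyColumn p q A)
      ≈⟨ +-congˡ (trans (*-congˡ (detMatrix-copyColumn A adj)) (zeroʳ t)) ⟩
    detMatrix A + 0#
      ≈⟨ +-identityʳ _ ⟩
    detMatrix A ∎

  -- Left kernels and reduction of the first row.

  infix 4 _annihilates_ _∼_

  -- `g` is a row vector in the left kernel: `matrix` stores images of basis elements as columns, so
  -- functionals act from the left.
  _annihilates_ : ∀ {n} → (Fin n → Carrier) → Matrix n → Set ℓ₁
  g annihilates A = ∀ k → sum (λ i → g i * A i k) ≈ 0#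

  Singular : ∀ {n} → Matrix n → Set (c ⊔ ℓ₁)
  Singular {n} A = Σ (Fin n → Carrier) λ g → g annihilates A × ¬ (∀ i → g i ≈ 0#)

  column-addColumn : ∀ {n} {p q : Fin n} t A (g : Fin n → Carrier) →
                     sum (λ i → g i * addColumn p q t A i p) ≈
                     sum (λ i → g i * A i p) + t * sum (λ i → g i * A i q)
  column-addColumn {p = p} {q} t A g = trans
    (sum-cong λ i → trans (*-congˡ (addColumn-updates p q t A i))
      (solve 4 (λ g a t b → g :* (a :+ t :* b) := g :* a :+ t :* (g :* b)) refl (g i) (A i p) t (A i q)))
    (sum-linear (λ i → g i * A i p) (λ i → g i * A i q) t)

  -- Column operations fix the left kernel itself, so the same `g` can appear on both sides.
  _∼_ : ∀ {n} → Matrix n → Matrix n → Set (c ⊔ ℓ₁)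
  A ∼ B = detMatrix A ≈ detMatrix B × ∀ g → g annihilates A ⇔ g annihilates B

  ∼-refl : ∀ {n} {A : Matrix n} → A ∼ A
  ∼-refl = refl , λ g → ⇔-id _

  ∼-trans : ∀ {n} {A B C : Matrix n} → A ∼ B → B ∼ C → A ∼ C
  ∼-trans (d , k) (d′ , k′) = trans d d′ , λ g → k′ g ⇔-∘ k g

  addColumn-∼ : ∀ {n} {p q : Fin (suc n)} t (A : Matrix (suc n)) → Adjacent p q → A ∼ addColumn p q t A
  addColumn-∼ {p = p} {q} t A adj = sym (detMatrix-addColumn t A adj) , λ g → mk⇔ (to g) (from g)
    where
    unchanged : ∀ g k → k ≢ p → sum (λ i → g i * addColumn p q t A i k) ≈ sum (λ i → g i * A i k)
    unchanged g k k≢p = sum-cong λ i → *-congˡ {g i} (addColumn-minimal p q t A i k k≢p)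

    to : ∀ g → g annihilates A → g annihilates addColumn p q t A
    to g gA≈0 k with k ≟ p
    ... | no k≢p     = trans (unchanged g k k≢p) (gA≈0 k)
    ... | yes ≡.refl = begin
      sum (λ i → g i * addColumn p q t A i p)                ≈⟨ column-addColumn t A g ⟩
      sum (λ i → g i * A i p) + t * sum (λ i → g i * A i q)  ≈⟨ +-cong (gA≈0 p) (*-congˡ (gA≈0 q)) ⟩
      0# + t * 0#                                            ≈⟨ trans (+-identityˡ _) (zeroʳ t) ⟩
      0#                                                     ∎

    from : ∀ g → g annihilates addColumn p q t A → g annihilates A
    from g gB≈0 = gA≈0
      where
      -- The columns other than `p` come first: among them is `q`, whose vanishing is needed to undo
      -- the operation on column `p`.
      off : ∀ k → k ≢ p → sum (λ i → g i * A i k) ≈ 0#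
      off k k≢p = trans (sym (unchanged g k k≢p)) (gB≈0 k)

      gA≈0 : g annihilates A
      gA≈0 k with k ≟ p
      ... | no k≢p     = off k k≢p
      ... | yes ≡.refl = begin
        sum (λ i → g i * A i p)                                ≈⟨ +-identityʳ _ ⟨
        sum (λ i → g i * A i p) + 0#                           ≈⟨ +-congˡ (trans (*-congˡ (off q (Adjacent⇒≢ adj))) (zeroʳ t)) ⟨
        sum (λ i → g i * A i p) + t * sum (λ i → g i * A i q)  ≈⟨ column-addColumn t A g ⟨
        sum (λ i → g i * addColumn p q t A i p)                ≈⟨ gB≈0 p ⟩
        0#                                                     ∎

  -- Nothing is asserted about the first-row entry at `inject₁ i`, because it may have to be changed
  -- to obtain a pivot.
  record ClearedAt {n} (i : Fin n) (A : Matrix (suc n)) : Set (c ⊔ ℓ₁) where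
    field
      result  : Matrix (suc n)
      related : A ∼ result
      cleared : result zero (suc i) ≈ 0#
      others  : ∀ k → k ≢ inject₁ i → k ≢ suc i → result zero k ≈ A zero k

  clear-with-pivot : ∀ {n} (i : Fin n) (A : Matrix (suc n)) → ¬ A zero (inject₁ i) ≈ 0# → ClearedAt i A
  clear-with-pivot i A x≉0 = record
    { result  = addColumn (suc i) (inject₁ i) t A
    ; related = addColumn-∼ t A (right i)
    ; cleared = begin
        addColumn (suc i) (inject₁ i) t A zero (suc i)  ≈⟨ addColumn-updates (suc i) (inject₁ i) t A zero ⟩
        y + - (y * x⁻¹) * x                             ≈⟨ +-congˡ (negated-quotient y xx⁻¹≈1) ⟩
        y + - y                                         ≈⟨ -‿inverseʳ y ⟩
        0#                                              ∎
    ; others  = λ k _ → addColumn-minimal (suc i) (inject₁ i) t A zero k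
    }
    where
    x = A zero (inject₁ i)
    y = A zero (suc i)
    x⁻¹ = proj₁ (inverse x x≉0)
    xx⁻¹≈1 = proj₂ (inverse x x≉0)
    -- Chosen so that `y + t * x` vanishes.
    t = - (y * x⁻¹)

  clear : ∀ {n} (i : Fin n) (A : Matrix (suc n)) → ClearedAt i A
  clear i A with A zero (suc i) ≈? 0# | A zero (inject₁ i) ≈? 0#
  ... | yes y≈0 | _       = record
    { result = A ; related = ∼-refl {A = A} ; cleared = y≈0 ; others = λ _ _ _ → refl }
  ... | no  _   | no x≉0  = clear-with-pivot i A x≉0
  -- The left neighbour is zero, so adding column `suc i` to it first makes the nonzero entry at
  -- `suc i` available as a pivot.
  ... | no  y≉0 | yes x≈0 = record
    { result  = result
    ; related = ∼-trans {A = A} {B} {result} (addColumn-∼ 1# A (left i)) related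
    ; cleared = cleared
    ; others  = λ k k≢i k≢1+i → trans (others k k≢i k≢1+i) (addColumn-minimal (inject₁ i) (suc i) 1# A zero k k≢i)
    }
    where
    B = addColumn (inject₁ i) (suc i) 1# A

    pivot : B zero (inject₁ i) ≈ A zero (suc i)
    pivot = trans (addColumn-updates (inject₁ i) (suc i) 1# A zero)
                  (trans (+-cong x≈0 (*-identityˡ _)) (+-identityˡ _))

    open ClearedAt (clear-with-pivot i B (λ b≈0 → y≉0 (trans (sym pivot) b≈0)))

  -- The row is swept from right to left. The step for `i` clears the entry at `suc i` and alters at
  -- most the entries at `inject₁ i` and `suc i`, so the zeros further right persist.
  clear-first-row : ∀ {n} (A : Matrix (suc n)) → Σ (Matrix (suc n)) λ B → A ∼ B × ∀ k → B zero (suc k) ≈ 0#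
  clear-first-row {n} A = let B , A∼B , zeros = >-weakInduction ClearedAfter none next zero in
    B , A∼B , λ k → zeros (suc k) z<s
    where
    ClearedAfter : Fin (suc n) → Set (c ⊔ ℓ₁)
    ClearedAfter m = Σ (Matrix (suc n)) λ B → A ∼ B × ∀ k → m < k → B zero k ≈ 0#

    none : ClearedAfter (fromℕ n)
    none = A , ∼-refl {A = A} , λ k n<k → contradiction (≤fromℕ k) (<⇒≱ n<k)

    next : ∀ i → ClearedAfter (suc i) → ClearedAfter (inject₁ i)
    next i (B , A∼B , zeros) = result , ∼-trans {A = A} {B} {result} A∼B related , zeros′
      where
      open ClearedAt (clear i B)

      zeros′ : ∀ k → inject₁ i < k → result zero k ≈ 0#
      zeros′ k i<k with k ≟ suc i
      ... | yes ≡.refl = cleared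
      ... | no k≢1+i   = trans (others k (<⇒≢ i<k ∘ ≡.sym) k≢1+i)
        (zeros k (≤∧≢⇒< (≡.subst (λ m → m ℕ.< toℕ k) (toℕ-inject₁ i) i<k) (k≢1+i ∘ ≡.sym)))

  -- Singularity and vanishing of the determinant.

  Singular-∼ : ∀ {n} {A B : Matrix n} → A ∼ B → Singular A ⇔ Singular B
  Singular-∼ (_ , k) = mk⇔ (λ (g , gA≈0 , g≉0) → g , Equivalence.to (k g) gA≈0 , g≉0)
                           (λ (g , gB≈0 , g≉0) → g , Equivalence.from (k g) gB≈0 , g≉0)

  detMatrix-lowerBlock : ∀ {n} (A : Matrix (suc n)) → (∀ k → A zero (suc k) ≈ 0#) →
                         detMatrix A ≈ A zero zero * detMatrix (minor A zero)
  detMatrix-lowerBlock A zeros = begin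
    expansion A zero + sum (λ k → expansion A (suc k))  ≈⟨ +-cong (*-identityˡ _) (sum-zero λ k →
      trans (*-congˡ {sign (suc k)} (trans (*-congʳ (zeros k)) (zeroˡ _))) (zeroʳ _)) ⟩
    A zero zero * detMatrix (minor A zero) + 0#         ≈⟨ +-identityʳ _ ⟩
    A zero zero * detMatrix (minor A zero)              ∎

  -- Let `a` be the corner entry after clearing. If `a` is zero, the whole first row is zero and
  -- both sides hold. Otherwise `a` cancels from the determinant, and vectors annihilating `B`
  -- correspond to those annihilating `M`: the later columns do not see the first coordinate, and
  -- column zero determines it from the rest.
  singular⇔det≈0 : ∀ {n} (A : Matrix n) → Singular A ⇔ detMatrix A ≈ 0#
  -- Both sides are false: the only empty vector is zero, and the empty determinant is one.
  singular⇔det≈0 {zero}  A = mk⇔ (λ (g , _ , g≉0) → contradiction (λ ()) g≉0) (λ 1≈0 → contradiction (sym 1≈0) 0≉1)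
  singular⇔det≈0 {suc n} A with B , A∼B , zeros ← clear-first-row A =
    mk⇔ (λ sing → trans (proj₁ A∼B) (trans detB (to (Equivalence.to (Singular-∼ {A = A} {B} A∼B) sing))))
        (λ det≈0 → Equivalence.from (Singular-∼ {A = A} {B} A∼B) (from (trans (sym (trans (proj₁ A∼B) detB)) det≈0)))
    where
    a = B zero zero
    M = minor B zero
    detB = detMatrix-lowerBlock B zeros

    cancel : ∀ {x} → ¬ a ≈ 0# → a * x ≈ 0# → x ≈ 0#
    cancel {x} a≉0 ax≈0 with a⁻¹ , aa⁻¹≈1 ← inverse a a≉0 = begin
      x              ≈⟨ *-identityˡ x ⟨
      1# * x         ≈⟨ *-congʳ aa⁻¹≈1 ⟨
      a * a⁻¹ * x    ≈⟨ solve 3 (λ a b x → a :* b :* x := b :* (a :* x)) refl a a⁻¹ x ⟩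
      a⁻¹ * (a * x)  ≈⟨ *-congˡ ax≈0 ⟩
      a⁻¹ * 0#       ≈⟨ zeroʳ a⁻¹ ⟩
      0#             ∎

    to : Singular B → a * detMatrix M ≈ 0#
    to (g , gB≈0 , g≉0) with a ≈? 0#
    ... | yes a≈0 = trans (*-congʳ a≈0) (zeroˡ _)
    ... | no  a≉0 = trans (*-congˡ (Equivalence.to (singular⇔det≈0 M) (g ∘ suc , g′M≈0 , g′≉0))) (zeroʳ a)
      where
      g′M≈0 : (g ∘ suc) annihilates M
      g′M≈0 k = begin
        sum (λ i → g (suc i) * M i k)                            ≈⟨ +-identityˡ _ ⟨
        0# + sum (λ i → g (suc i) * M i k)                       ≈⟨ +-congʳ (trans (*-congˡ (zeros k)) (zeroʳ _)) ⟨
        g zero * B zero (suc k) + sum (λ i → g (suc i) * M i k)  ≈⟨ gB≈0 (suc k) ⟩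
        0#                                                       ∎

      g′≉0 : ¬ (∀ i → g (suc i) ≈ 0#)
      -- If the tail vanished, column zero would reduce to `g zero * a ≈ 0#`, forcing `g zero` to
      -- vanish too.
      g′≉0 g′≈0 = g≉0 λ where
        zero    → cancel a≉0 (begin
          a * g zero                                              ≈⟨ *-comm a (g zero) ⟩
          g zero * a                                              ≈⟨ +-identityʳ _ ⟨
          g zero * a + 0#                                         ≈⟨ +-congˡ (sum-zero (λ i → trans (*-congʳ (g′≈0 i)) (zeroˡ _))) ⟨
          g zero * a + sum (λ i → g (suc i) * B (suc i) zero)     ≈⟨ gB≈0 zero ⟩
          0#                                                      ∎)
        (suc i) → g′≈0 i

    from : a * detMatrix M ≈ 0# → Singular B
    from aM≈0 with a ≈? 0#
    -- The first row of `B` is zero, and the first unit row vector picks it out.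
    ... | yes a≈0 = basis zero , annihilates , λ e≈0 → 0≉1 (sym (e≈0 zero))
      where
      row : ∀ k → B zero k ≈ 0#
      row zero    = a≈0
      row (suc k) = zeros k

      annihilates : basis zero annihilates B
      annihilates k = trans (+-cong (trans (*-congˡ (row k)) (zeroʳ _))
                                    (sum-zero {n} (λ i → zeroˡ (B (suc i) k))))
                            (+-identityˡ 0#)
    ... | no a≉0
      with g , gM≈0 , g≉0 ← Equivalence.from (singular⇔det≈0 M) (cancel a≉0 aM≈0)
         | a⁻¹ , aa⁻¹≈1 ← inverse a a≉0 = (- (S * a⁻¹) ◁ g) , annihilates , λ g₊≈0 → g≉0 (g₊≈0 ∘ suc)
      where
      -- Column zero requires `x * a + S ≈ 0#` of the new first coordinate `x`, whence
      -- `- (S * a⁻¹)`.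
      S = sum (λ i → g i * B (suc i) zero)

      annihilates : (- (S * a⁻¹) ◁ g) annihilates B
      annihilates zero    = begin
        - (S * a⁻¹) * a + S  ≈⟨ +-congʳ (negated-quotient S aa⁻¹≈1) ⟩
        - S + S              ≈⟨ -‿inverseˡ S ⟩
        0#                   ∎
      annihilates (suc k) = trans (+-cong (trans (*-congˡ (zeros k)) (zeroʳ _)) (gM≈0 k)) (+-identityˡ 0#)

-- Linear functionals on free modules.

module Functionals {c ℓ₁ ℓ₂ : Level} (ℝ : RealNumbers c ℓ₁ ℓ₂) where
  open RealNumbers ℝ
  open LinearAlgebra ℝ
  open Determinant ℝ using (sum-cong; sum-zero)
  open CommutativeRing commutativeRing
    using ( refl; sym; trans; setoid; +-cong; +-congˡ; *-congˡ; *-congʳ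
          ; +-identityˡ; +-identityʳ; *-identityˡ; zeroˡ; zeroʳ; *-comm; distribˡ )
  open SemiringSum semiring using (sum)
  open SetoidReasoning setoid

  module Functional {m ℓm : Level} {M : LeftModule ring m ℓm} (h : Dual M) where
    open LeftModule M
    open LeftModuleMorphisms.IsLeftModuleHomomorphism (Hom.isLeftModuleHomomorphism h) public
      using (+ᴹ-homo; 0ᴹ-homo; -ᴹ-homo; *ₗ-homo; ⟦⟧-cong)

    ⟦⟧-sum : ∀ {n} (x : Fin n → Carrierᴹ) →
             ⟦ h ⟧ (CommutativeMonoidSum.sum +ᴹ-commutativeMonoid x) ≈ sum (⟦ h ⟧ ∘ x)
    ⟦⟧-sum {zero}  x = 0ᴹ-homo
    ⟦⟧-sum {suc n} x = trans (+ᴹ-homo _ _) (+-congˡ (⟦⟧-sum (x ∘ suc)))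

    ⟦⟧-∑ : {A : Set} (xs : List A) (f : A → Carrierᴹ) →
           ⟦ h ⟧ (ListSum.∑ +ᴹ-commutativeMonoid xs f) ≈ ListSum.∑ +-commutativeMonoid xs (⟦ h ⟧ ∘ f)
    ⟦⟧-∑ []       f = 0ᴹ-homo
    ⟦⟧-∑ (x ∷ xs) f = trans (+ᴹ-homo _ _) (+-congˡ (⟦⟧-∑ xs f))

    ⟦⟧-linearCombination : ∀ {n} (x : Fin n → Carrier) (b : Fin n → Carrierᴹ) →
                           ⟦ h ⟧ (⟦ linearExtension M b ⟧ x) ≈ sum (λ i → x i * ⟦ h ⟧ (b i))
    ⟦⟧-linearCombination x b = trans (⟦⟧-sum (λ i → x i *ₗ b i)) (sum-cong λ i → *ₗ-homo (x i) (b i))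

  ∑-cong : {A : Set} (xs : List A) {f g : A → Carrier} → (∀ x → f x ≈ g x) →
           ListSum.∑ +-commutativeMonoid xs f ≈ ListSum.∑ +-commutativeMonoid xs g
  ∑-cong []       f≈g = refl
  ∑-cong (x ∷ xs) f≈g = +-cong (f≈g x) (∑-cong xs f≈g)

  *-distribˡ-∑ : {A : Set} (a : Carrier) (xs : List A) (f : A → Carrier) →
                 a * ListSum.∑ +-commutativeMonoid xs f ≈ ListSum.∑ +-commutativeMonoid xs (λ x → a * f x)
  *-distribˡ-∑ a []       f = zeroʳ a
  *-distribˡ-∑ a (x ∷ xs) f = trans (distribˡ a _ _) (+-congˡ (*-distribˡ-∑ a xs f))

  sum-basis : ∀ {n} (v : Fin n) (x : Fin n → Carrier) → sum (λ i → basis v i * x i) ≈ x v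
  sum-basis zero    x = trans (+-cong (*-identityˡ _) (sum-zero λ i → zeroˡ (x (suc i)))) (+-identityʳ _)
  sum-basis (suc v) x = trans
    (+-cong (zeroˡ _) (trans (sum-cong λ i → *-congʳ (basis-suc v i)) (sum-basis v (x ∘ suc))))
    (+-identityˡ _)
    where
    basis-suc : ∀ {n} (v i : Fin n) → basis (suc v) (suc i) ≈ basis v i
    basis-suc v i with v ≟ i
    ... | yes _ = refl
    ... | no  _ = refl

  -- Reconciles `sum-basis`, which sums over the coordinates of one basis vector, with a linear
  -- combination, where a fixed coordinate is summed over all basis vectors.
  basis-symmetric : ∀ {n} (i j : Fin n) → basis i j ≈ basis j i
  basis-symmetric i j with i ≟ j | j ≟ i
  ... | yes _   | yes _   = refl
  ... | no  _   | no  _   = refl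
  ... | yes i≡j | no  j≢i = contradiction (≡.sym i≡j) j≢i
  ... | no  i≢j | yes j≡i = contradiction (≡.sym j≡i) i≢j

  sum-coordinate : ∀ {k n} (x : Fin k → Fin n → Carrier) j →
                   CommutativeMonoidSum.sum (LeftModule.+ᴹ-commutativeMonoid (Free n)) x j ≈ sum (λ i → x i j)
  sum-coordinate {zero}  x j = refl
  sum-coordinate {suc k} x j = +-congˡ (sum-coordinate (x ∘ suc) j)

  -- The linear extension of the basis is the identity, so `x` may be replaced by a linear
  -- combination of basis vectors, through which `h` passes.
  functional-expansion : ∀ {n} (h : Dual (Free n)) x → ⟦ h ⟧ x ≈ sum (λ i → x i * ⟦ h ⟧ (basis i))
  functional-expansion {n} h x = trans (⟦⟧-cong coordinates) (⟦⟧-linearCombination x basis)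
    where
    open Functional h

    coordinates : ∀ j → x j ≈ ⟦ linearExtension (Free n) basis ⟧ x j
    coordinates j = sym (begin
      ⟦ linearExtension (Free n) basis ⟧ x j  ≈⟨ sum-coordinate (λ i k → x i * basis i k) j ⟩
      sum (λ i → x i * basis i j)             ≈⟨ sum-cong (λ i → trans (*-comm (x i) _) (*-congʳ (basis-symmetric i j))) ⟩
      sum (λ i → basis j i * x i)             ≈⟨ sum-basis j x ⟩
      x j                                     ∎)

  zero-on-basis : ∀ {n} (h : Dual (Free n)) → (∀ i → ⟦ h ⟧ (basis i) ≈ 0#) → IsZero h
  zero-on-basis h h≈0 x = trans (functional-expansion h x) (sum-zero λ i → trans (*-congˡ (h≈0 i)) (zeroʳ (x i)))

-- Graph weights, cocycles and the boundary matrix.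

module Proposition {c ℓ₁ ℓ₂ : Level} (ℝ : RealNumbers c ℓ₁ ℓ₂) (E : FiniteDigraph)
                   (λ₀ : RealNumbers.Carrier ℝ) where
  open RealNumbers ℝ
  open FiniteDigraph E
  open LinearAlgebra ℝ
  open Weights ℝ E
  open ChainComplex ℝ E λ₀
  open Determinant ℝ using (sum-cong; Singular; singular⇔det≈0)
  open Functionals ℝ
  open CommutativeRing commutativeRing
    using ( refl; sym; trans; setoid; +-cong; +-congˡ; +-congʳ; *-cong; *-congˡ
          ; +-identityˡ; +-identityʳ; +-assoc; -‿inverseˡ; -‿inverseʳ; *-comm )
  open SemiringSum semiring using (sum)
  open SetoidReasoning setoid
  open ListSum +-commutativeMonoid using (∑)

  fromValues : (E⁰ → Carrier) → C⁰
  fromValues g = linearExtension scalars g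

  fromValues-basis : ∀ g v → ⟦ fromValues g ⟧ (basis v) ≈ g v
  fromValues-basis g v = sum-basis v g

  -- Column `k` of `matrix ∂` is the image of the basis vector `k`, so the row vector of values of
  -- `h` times this column is `h` applied to that image, the value of `δ h` on the basis vector `k`.
  H⁰≠0⇔singular : H⁰≠0 ⇔ Singular (matrix ∂)
  H⁰≠0⇔singular = mk⇔ to from
    where
    to : H⁰≠0 → Singular (matrix ∂)
    to (h , δh≈0 , h≉0) = (λ v → ⟦ h ⟧ (basis v)) , annihilates , h≉0 ∘ zero-on-basis h
      where
      annihilates : ∀ k → sum (λ i → ⟦ h ⟧ (basis i) * matrix ∂ i k) ≈ 0#
      annihilates k = begin
        sum (λ i → ⟦ h ⟧ (basis i) * matrix ∂ i k)  ≈⟨ sum-cong (λ i → *-comm _ (matrix ∂ i k)) ⟩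
        sum (λ i → matrix ∂ i k * ⟦ h ⟧ (basis i))  ≈⟨ functional-expansion h (⟦ ∂ ⟧ (basis k)) ⟨
        ⟦ h ⟧ (⟦ ∂ ⟧ (basis k))                     ≈⟨ δh≈0 (basis k) ⟩
        0#                                          ∎

    from : Singular (matrix ∂) → H⁰≠0
    from (g , gA≈0 , g≉0) = fromValues g , zero-on-basis (δ (fromValues g)) onBasis ,
      λ h≈0 → g≉0 λ v → trans (sym (fromValues-basis g v)) (h≈0 (basis v))
      where
      onBasis : ∀ k → ⟦ δ (fromValues g) ⟧ (basis k) ≈ 0#
      onBasis k = trans (sum-cong λ i → *-comm (matrix ∂ i k) (g i)) (gA≈0 k)

  module _ (h : C⁰) where
    open Functional h
    open LeftModule C₀ using (Carrierᴹ; _+ᴹ_; _*ₗ_; -ᴹ_; 0ᴹ; +ᴹ-commutativeMonoid)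
    open ListSum +ᴹ-commutativeMonoid using () renaming (∑ to ∑ᴹ)

    value : E⁰ → Carrier
    value v = ⟦ h ⟧ (basis v)

    coboundary-basis : ∀ v → ⟦ δ h ⟧ (basis v) ≈ ⟦ h ⟧ (∂B v)
    coboundary-basis v = trans (⟦⟧-linearCombination (basis v) ∂B) (sum-basis v (⟦ h ⟧ ∘ ∂B))

    -- `∂B v` with the edge list as a variable, so that cases can be distinguished on it; at `B v`
    -- it is `∂B v` by definition.
    boundary-of : List E¹ → E⁰ → Carrierᴹ
    boundary-of es v = if null es then 0ᴹ else λ₀ *ₗ ∑ᴹ es (λ e → basis (r e)) +ᴹ -ᴹ basis v

    value-nonempty : ∀ es v → ⟦ h ⟧ (λ₀ *ₗ ∑ᴹ es (λ e → basis (r e)) +ᴹ -ᴹ basis v) ≈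
                              ∑ es (λ e → λ₀ * value (r e)) + - value v
    value-nonempty es v = trans (+ᴹ-homo _ _) (+-cong
      (trans (*ₗ-homo λ₀ _)
        (trans (*-congˡ (⟦⟧-∑ es (λ e → basis (r e)))) (*-distribˡ-∑ λ₀ es (λ e → value (r e)))))
      (-ᴹ-homo _))

    x-y≈0⇒y≈x : ∀ {x y} → x + - y ≈ 0# → y ≈ x
    x-y≈0⇒y≈x {x} {y} x-y≈0 = begin
      y              ≈⟨ +-identityˡ y ⟨
      0# + y         ≈⟨ +-congʳ x-y≈0 ⟨
      x + - y + y    ≈⟨ +-assoc x (- y) y ⟩
      x + (- y + y)  ≈⟨ +-congˡ (-‿inverseˡ y) ⟩
      x + 0#         ≈⟨ +-identityʳ x ⟩
      x              ∎

    WeightCondition : List E¹ → E⁰ → Set ℓ₁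
    WeightCondition es v = ¬ es ≡ [] → value v ≈ ∑ es (λ e → λ₀ * value (r e))

    -- With no edges the boundary is zero and the condition is vacuous. Otherwise linearity turns
    -- `h` of the boundary into the weighted sum minus `value v`.
    vanishes⇔weightCondition : ∀ es v → ⟦ h ⟧ (boundary-of es v) ≈ 0# ⇔ WeightCondition es v
    vanishes⇔weightCondition []          v = mk⇔ (λ _ nonempty → contradiction ≡.refl nonempty) (λ _ → 0ᴹ-homo)
    vanishes⇔weightCondition es@(_ ∷ _) v = mk⇔
      (λ h≈0 _ → x-y≈0⇒y≈x (trans (sym (value-nonempty es v)) h≈0))
      (λ weight → trans (value-nonempty es v) (trans (+-congʳ (sym (weight λ ()))) (-‿inverseʳ (value v))))

    -- A functional vanishes once it does so on the basis, here the formal symbols of the edge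
    -- bundles, so the previous equivalence can be applied vertex by vertex.
    cocycle⇔weight : H⁰ h ⇔ (∀ v → WeightCondition (B v) v)
    cocycle⇔weight = mk⇔
      (λ δh≈0 v → Equivalence.to (vanishes⇔weightCondition (B v) v) (trans (sym (coboundary-basis v)) (δh≈0 (basis v))))
      (λ weight → zero-on-basis (δ h) λ v →
        trans (coboundary-basis v) (Equivalence.from (vanishes⇔weightCondition (B v) v) (weight v)))

  -- Linear extension from the vertices and restriction to them translate one side into the other;
  -- nontriviality carries over because a functional is zero exactly when its vertex values are.
  weight⇔H⁰≠0 : HasNontrivialSpecialWeight λ₀ ⇔ H⁰≠0
  weight⇔H⁰≠0 = mk⇔ to from
    where
    to : HasNontrivialSpecialWeight λ₀ → H⁰≠0
    to (w , special , g≉0) = h , Equivalence.from (cocycle⇔weight h) weight ,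
      λ h≈0 → g≉0 λ v → trans (sym (fromValues-basis g v)) (h≈0 (basis v))
      where
      open GeneralizedGraphWeight w

      h : C⁰
      h = fromValues g

      weight : ∀ v → WeightCondition h (B v) v
      weight v nonempty = begin
        value h v
          ≈⟨ fromValues-basis g v ⟩
        g v
          ≈⟨ condition v nonempty ⟩
        ∑ (B v) (λ e → edge e * g (r e))
          ≈⟨ ∑-cong (B v) (λ e → *-cong (special e) (sym (fromValues-basis g (r e)))) ⟩
        ∑ (B v) (λ e → λ₀ * value h (r e)) ∎

    from : H⁰≠0 → HasNontrivialSpecialWeight λ₀
    from (h , δh≈0 , h≉0) =
      record { g = value h ; edge = const λ₀ ; condition = Equivalence.to (cocycle⇔weight h) δh≈0 } ,
      (λ _ → refl) , h≉0 ∘ zero-on-basis h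

proposition2p6 :
    {c ℓ₁ ℓ₂ : Level} (ℝ : RealNumbers c ℓ₁ ℓ₂)
    (E : FiniteDigraph) (λ₀ : RealNumbers.Carrier ℝ) →
    let open RealNumbers ℝ
        open LinearAlgebra ℝ
        open Weights ℝ E
        open ChainComplex ℝ E λ₀
    in (HasNontrivialSpecialWeight λ₀ ⇔ H⁰≠0) × (H⁰≠0 ⇔ det ∂ ≈ 0#)
proposition2p6 ℝ E λ₀ =
  -- `det ∂` is by definition `detMatrix (matrix ∂)`, so singularity of that matrix is the link
  -- between cohomology and determinant.
  weight⇔H⁰≠0 , Determinant.singular⇔det≈0 ℝ (LinearAlgebra.matrix ℝ (ChainComplex.∂ ℝ E λ₀)) ⇔-∘ H⁰≠0⇔singular
  where open Proposition ℝ E λ₀
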